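{- For every co-comparability graph $G$, $\operatorname{box}(G)\le 2\Delta(G)+1$, where $\Delta(G)$ is the maximum degree of $G$.
   Context: A comparability graph is a graph whose vertex set admits a partial order such that two distinct vertices are adjacent iff they are comparable; $G$ is a co-comparability graph if its complement is a comparability graph. The boxicity $\operatorname{box}(G)$ is the minimum $b$ such that $G$ is the intersection graph of axis-parallel boxes in $\mathbb{R}^b$ (products of $b$ closed intervals), one box per vertex. -}

module Defs where

open import Data.Fin.Base using (Fin)
open import Data.Fin.Properties using (_≟_)
open import Data.List.Base using (length; filter; map; allFin)
open import Data.List.Extrema.Nat using (max)
open import Data.Nat.Base as ℕ using (ℕ)
open import Data.Product.Base using (Σ-syntax; ∃-syntax; _×_; _,_)
open import Data.Rational.Base as ℚ using (ℚ)
open import Data.Sum.Base using (_⊎_)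
open import Function.Bundles using (_⇔_)
open import Level using (0ℓ)
open import Relation.Binary.Core using (Rel)
open import Relation.Binary.Definitions using (Decidable; Symmetric; Irreflexive)
open import Relation.Binary.PropositionalEquality.Core using (_≡_; _≢_; ≢-sym)
open import Relation.Binary.Structures using (IsPartialOrder)
open import Relation.Nullary.Decidable.Core using (_×-dec_; ¬?)
open import Relation.Nullary.Negation.Core using (¬_)

-- Real numbers as two-sided Dedekind cuts of rationals.
record ℝ : Set₁ where
  field
    L U         : ℚ → Set
    L-inhabited : ∃[ q ] L q
    U-inhabited : ∃[ q ] U q
    L-closed    : ∀ {q r} → q ℚ.< r → L r → L q
    U-closed    : ∀ {q r} → q ℚ.< r → U q → U r
    L-open      : ∀ {q} → L q → ∃[ r ] (q ℚ.< r × L r)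
    U-open      : ∀ {r} → U r → ∃[ q ] (q ℚ.< r × U q)
    disjoint    : ∀ {q} → ¬ (L q × U q)
    located     : ∀ {q r} → q ℚ.< r → L q ⊎ U r

infix 4 _≤ᴿ_
_≤ᴿ_ : ℝ → ℝ → Set
x ≤ᴿ y = ∀ q → ℝ.L x q → ℝ.L y q

record ClosedInterval : Set₁ where
  field
    lo hi : ℝ
    lo≤hi : lo ≤ᴿ hi

infix 4 _∈ᴵ_ _∈ᴮ_
_∈ᴵ_ : ℝ → ClosedInterval → Set
x ∈ᴵ I = ClosedInterval.lo I ≤ᴿ x × x ≤ᴿ ClosedInterval.hi I

Point : ℕ → Set₁
Point b = Fin b → ℝ

Box : ℕ → Set₁
Box b = Fin b → ClosedInterval

_∈ᴮ_ : ∀ {b} → Point b → Box b → Set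
p ∈ᴮ B = ∀ i → p i ∈ᴵ B i

Intersect : ∀ {b} → Box b → Box b → Set₁
Intersect {b} B C = Σ[ p ∈ Point b ] (p ∈ᴮ B × p ∈ᴮ C)

-- Finite simple graphs on the vertex set Fin n.
record Graph (n : ℕ) : Set₁ where
  field
    Adj    : Rel (Fin n) 0ℓ
    adj?   : Decidable Adj
    symm   : Symmetric Adj
    irrefl : Irreflexive _≡_ Adj

module _ {n : ℕ} (G : Graph n) where
  open Graph G

  complement : Graph n
  complement = record
    { Adj    = λ u v → u ≢ v × ¬ Adj u v
    ; adj?   = λ u v → ¬? (u ≟ v) ×-dec ¬? (adj? u v)
    ; symm   = λ (u≢v , ¬uv) → ≢-sym u≢v , λ vu → ¬uv (symm vu)
    ; irrefl = λ u≡v (u≢v , _) → u≢v u≡v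
    }

  degree : Fin n → ℕ
  degree v = length (filter (adj? v) (allFin n))

  -- Equal to 0 for the graph without vertices.
  Δ : ℕ
  Δ = max 0 (map degree (allFin n))

  IsComparability : Set₁
  IsComparability =
    Σ[ _⊑_ ∈ Rel (Fin n) 0ℓ ]
      (IsPartialOrder _≡_ _⊑_ ×
       (∀ u v → u ≢ v → Adj u v ⇔ (u ⊑ v ⊎ v ⊑ u)))

  IsBoxIntersectionGraph : ℕ → Set₁
  IsBoxIntersectionGraph b =
    Σ[ box ∈ (Fin n → Box b) ]
      (∀ u v → u ≢ v → Adj u v ⇔ Intersect (box u) (box v))

  -- IsBoxicity b says box(G) = b.  In dimension 0 the only box is the
  -- one-point space ℝ⁰, so complete graphs have boxicity 0.
  IsBoxicity : ℕ → Set₁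
  IsBoxicity b =
    IsBoxIntersectionGraph b × (∀ c → IsBoxIntersectionGraph c → b ℕ.≤ c)

IsCoComparability : ∀ {n} → Graph n → Set₁
IsCoComparability G = IsComparability (complement G)

{-# OPTIONS --safe #-}

-- Dropping reals, a box representation in dimension c is a family of c interval
-- orders ("lies entirely to the left of") such that distinct vertices are
-- adjacent iff no order of the family relates them.  Such families can be
-- searched exhaustively, which is what makes the exact boxicity computable.
--
-- For the bound, extend the order of the complement to a linear order.  If u is
-- adjacent to v, every x strictly between them is adjacent to u or to v, since
-- otherwise u ⊏ x ⊏ v; hence the positions of u and v differ by at most
-- w = 2Δ.  Colour the vertices by position modulo w + 1.  For each colour c, let
-- u lie left of v when u has colour c, precedes v, and no vertex of colour c up
-- to u is adjacent to v.  This is an interval order, and it separates any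
-- non-adjacent u before v when c is the colour of u: the other vertices of this
-- colour preceding u are too far from v to be adjacent to it.

module Submission where

open import Defs
open import Data.Bool.Base using (Bool; true)
open import Data.Fin.Base as Fin using (Fin; toℕ; fromℕ<; combine; remQuot)
open import Data.Fin.Properties as Fin using (all?; any?; sequence; remQuot-combine; toℕ-fromℕ<; combine-monoˡ-<; combine-injectiveʳ)
open import Data.Fin.Subset using (Subset; _∈_)
open import Data.Fin.Subset.Properties using (_∈?_; anySubset?)
import Data.Integer.Base as ℤ
import Data.Integer.Properties as ℤ
open import Data.List.Base using ([]; _∷_; length; filter; map; allFin)
open import Data.List.Extrema.Nat using (xs≤max)
open import Data.List.Membership.Propositional using () renaming (_∈_ to _∈ₗ_)
open import Data.List.Membership.Propositional.Properties using (∈-allFin)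
open import Data.List.Properties using (length-filter; length-tabulate)
open import Data.List.Relation.Unary.All as All using ()
open import Data.List.Relation.Unary.All.Properties using (map⁻)
open import Data.List.Relation.Unary.Any using (here; there)
open import Data.Nat.Base using (ℕ; zero; suc; _+_; _*_; _≤_; _<_; _⊔_; z≤n; s≤s; NonZero)
open import Data.Nat.DivMod using (_%_; _/_; _mod_; m≡m%n+[m/n]*n; m%n<n)
open import Data.Nat.Properties as ℕ using (module ≤-Reasoning)
open import Data.Product.Base using (∃-syntax; _×_; _,_; proj₁; proj₂; uncurry)
open import Data.Rational.Base as ℚ using (ℚ; *<*)
open import Data.Rational.Literals using (fromℤ)
import Data.Rational.Properties as ℚ
open import Data.Sum.Base as Sum using (_⊎_; inj₁; inj₂; [_,_]′)
open import Data.Vec.Base using (lookup; tabulate)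
open import Data.Vec.Properties using (lookup∘tabulate; []=⇒lookup; lookup⇒[]=)
open import Effect.Monad using (RawMonad)
open import Function.Base using (_∘_; id)
open import Function.Bundles using (_⇔_; mk⇔; Equivalence)
open import Function.Definitions using (Injective)
open import Level using (Level; 0ℓ)
open import Relation.Binary.Core using (Rel)
open import Relation.Binary.Definitions using (Decidable; tri<; tri≈; tri>)
open import Relation.Binary.PropositionalEquality using (_≡_; _≢_; refl; sym; trans; cong; subst; subst₂)
open import Relation.Binary.Structures using (IsPartialOrder)
open import Relation.Nullary.Decidable using (Dec; yes; no; does; _×-dec_; _⊎-dec_; _→-dec_; ¬?; decidable-stable; dec-true; ¬¬-excluded-middle)
open import Relation.Nullary.Negation using (¬_; contradiction; ¬¬-Monad)
import Relation.Unary as U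

open Equivalence using (to; from)

private
  variable
    a p q r : Level
    A : Set a
    c n : ℕ

-- Double negation over finite families, least witnesses, remainders.

¬¬-sequence : {P : Fin n → Set} → (∀ i → ¬ ¬ P i) → ¬ ¬ (∀ i → P i)
¬¬-sequence = sequence (RawMonad.rawApplicative ¬¬-Monad)

least-witness : {P : ℕ → Set p} → (∀ k → Dec (P k)) → ∀ m → P m →
                ∃[ b ] (P b × b ≤ m × (∀ k → P k → b ≤ k))
least-witness P? zero    Pm = zero , Pm , z≤n , λ _ _ → z≤n
least-witness {P = P} P? (suc m) Pm with P? zero
... | yes P0 = zero , P0 , z≤n , λ _ _ → z≤n
... | no ¬P0 with b , Pb , b≤m , least ← least-witness (P? ∘ suc) m Pm =
  suc b , Pb , s≤s b≤m , least′
  where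
  least′ : ∀ k → P k → suc b ≤ k
  least′ zero    P0 = contradiction P0 ¬P0
  least′ (suc k) Pk = s≤s (least k Pk)

-- Equal remainders and `m < k` would force `m / d < k / d`, so `k` would exceed `m` by at least a
-- full `d`.
close⇒%-distinct : ∀ {m k} d .{{_ : NonZero d}} → m < k → k < m + d → m % d ≢ k % d
close⇒%-distinct {m} {k} d m<k k<m+d m%d≡k%d = ℕ.<-irrefl refl (begin-strict
  k                            <⟨ k<m+d ⟩
  m + d                        ≡⟨ cong (_+ d) (m≡m%n+[m/n]*n m d) ⟩
  m % d + m / d * d + d        ≡⟨ ℕ.+-assoc (m % d) _ d ⟩
  m % d + (m / d * d + d)      ≡⟨ cong ((m % d) +_) (ℕ.+-comm _ d) ⟩
  m % d + suc (m / d) * d      ≤⟨ ℕ.+-monoʳ-≤ (m % d) (ℕ.*-monoˡ-≤ d m/d<k/d) ⟩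
  m % d + k / d * d            ≡⟨ cong (_+ k / d * d) m%d≡k%d ⟩
  k % d + k / d * d            ≡⟨ m≡m%n+[m/n]*n k d ⟨
  k                            ∎)
  where
  open ≤-Reasoning
  m/d<k/d : m / d < k / d
  m/d<k/d = ℕ.*-cancelʳ-< d (m / d) (k / d) (ℕ.+-cancelˡ-< (m % d) _ _
    (subst₂ _<_ (m≡m%n+[m/n]*n m d)
      (trans (m≡m%n+[m/n]*n k d) (cong (_+ k / d * d) (sym m%d≡k%d))) m<k))

-- Counting

module _ {P : U.Pred A p} {Q : U.Pred A q} (P? : U.Decidable P) (Q? : U.Decidable Q) where

  length-filter-⊆ : P U.⊆ Q → ∀ xs → length (filter P? xs) ≤ length (filter Q? xs)
  length-filter-⊆ P⊆Q []       = z≤n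
  length-filter-⊆ P⊆Q (x ∷ xs) with ih ← length-filter-⊆ P⊆Q xs | P? x | Q? x
  ... | yes _  | yes _  = s≤s ih
  ... | yes Px | no ¬Qx = contradiction (P⊆Q Px) ¬Qx
  ... | no _   | yes _  = ℕ.m≤n⇒m≤1+n ih
  ... | no _   | no _   = ih

  length-filter-⊂ : P U.⊆ Q → ∀ {y xs} → y ∈ₗ xs → ¬ P y → Q y →
                    length (filter P? xs) < length (filter Q? xs)
  length-filter-⊂ P⊆Q {y} {_ ∷ xs} (here refl) ¬Py Qy with P? y | Q? y
  ... | yes Py | _      = contradiction Py ¬Py
  ... | no _   | yes _  = s≤s (length-filter-⊆ P⊆Q xs)
  ... | no _   | no ¬Qy = contradiction Qy ¬Qy
  length-filter-⊂ P⊆Q {y} {x ∷ _} (there y∈xs) ¬Py Qy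
    with ih ← length-filter-⊂ P⊆Q y∈xs ¬Py Qy | P? x | Q? x
  ... | yes _  | yes _  = s≤s ih
  ... | yes Px | no ¬Qx = contradiction (P⊆Q Px) ¬Qx
  ... | no _   | yes _  = ℕ.m≤n⇒m≤1+n ih
  ... | no _   | no _   = ih

length-filter-∪ : {P : U.Pred A p} {Q : U.Pred A q} {R : U.Pred A r}
  (P? : U.Decidable P) (Q? : U.Decidable Q) (R? : U.Decidable R) →
  P U.⊆ (Q U.∪ R) → ∀ xs →
  length (filter P? xs) ≤ length (filter Q? xs) + length (filter R? xs)
length-filter-∪ P? Q? R? P⊆Q∪R [] = z≤n
length-filter-∪ P? Q? R? P⊆Q∪R (x ∷ xs)
  with ih ← length-filter-∪ P? Q? R? P⊆Q∪R xs | P? x | Q? x | R? x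
... | no _   | no _   | no _   = ih
... | no _   | no _   | yes _  = ℕ.≤-trans ih (ℕ.+-monoʳ-≤ _ (ℕ.n≤1+n _))
... | no _   | yes _  | no _   = ℕ.m≤n⇒m≤1+n ih
... | no _   | yes _  | yes _  = ℕ.m≤n⇒m≤1+n (ℕ.≤-trans ih (ℕ.+-monoʳ-≤ _ (ℕ.n≤1+n _)))
... | yes _  | yes _  | no _   = s≤s ih
... | yes _  | yes _  | yes _  = s≤s (ℕ.≤-trans ih (ℕ.+-monoʳ-≤ _ (ℕ.n≤1+n _)))
... | yes _  | no _   | yes _  = ℕ.≤-trans (s≤s ih) (ℕ.≤-reflexive (sym (ℕ.+-suc _ _)))
... | yes Px | no ¬Qx | no ¬Rx = contradiction (P⊆Q∪R Px) [ ¬Qx , ¬Rx ]′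

count : {P : U.Pred (Fin n) p} → U.Decidable P → ℕ
count {n = n} P? = length (filter P? (allFin n))

count-≤ : {P : U.Pred (Fin n) p} (P? : U.Decidable P) → count P? ≤ n
count-≤ {n = n} P? = ℕ.≤-trans (length-filter P? (allFin n)) (ℕ.≤-reflexive (length-tabulate {n = n} id))

-- Real numbers

≤ᴿ-trans : ∀ x y z → x ≤ᴿ y → y ≤ᴿ z → x ≤ᴿ z
≤ᴿ-trans x y z x≤y y≤z q = y≤z q ∘ x≤y q

≤ᴿ-refl : ∀ x → x ≤ᴿ x
≤ᴿ-refl x q = id

-- Openness gives some `r` above `q` in the lower cut of `y`. Locatedness of `x` then puts `q` below
-- `x`, or else `r` above `x`, and the latter would give `x ≤ᴿ y`.
≰ᴿ⇒≥ᴿ : ∀ x y → ¬ x ≤ᴿ y → y ≤ᴿ x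
≰ᴿ⇒≥ᴿ x y x≰y q Lyq with r , q<r , Lyr ← ℝ.L-open y Lyq | ℝ.located x q<r
... | inj₁ Lxq = Lxq
... | inj₂ Uxr = contradiction x≤y x≰y
  where
  x≤y : x ≤ᴿ y
  x≤y s Lxs with ℚ.<-cmp s r
  ... | tri< s<r _ _  = ℝ.L-closed y s<r Lyr
  ... | tri≈ _ refl _ = Lyr
  ... | tri> _ _ r<s  = contradiction (ℝ.L-closed x r<s Lxs , Uxr) (ℝ.disjoint x)

¬¬-≤ᴿ-total : ∀ x y → ¬ ¬ (x ≤ᴿ y ⊎ y ≤ᴿ x)
¬¬-≤ᴿ-total x y ¬total = ¬total (inj₂ (≰ᴿ⇒≥ᴿ x y (¬total ∘ inj₁)))

fromℚ : ℚ → ℝ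
fromℚ x = record
  { L           = ℚ._< x
  ; U           = x ℚ.<_
  ; L-inhabited = x ℚ.- ℚ.1ℚ , subst (x ℚ.- ℚ.1ℚ ℚ.<_) (ℚ.+-identityʳ x) (ℚ.+-monoʳ-< x (*<* ℤ.-<+))
  ; U-inhabited = x ℚ.+ ℚ.1ℚ , subst (ℚ._< x ℚ.+ ℚ.1ℚ) (ℚ.+-identityʳ x) (ℚ.+-monoʳ-< x (*<* (ℤ.+<+ (s≤s z≤n))))
  ; L-closed    = ℚ.<-trans
  ; U-closed    = λ q<r x<q → ℚ.<-trans x<q q<r
  ; L-open      = λ q<x → let r , q<r , r<x = ℚ.<-dense q<x in r , q<r , r<x
  ; U-open      = λ x<r → let q , x<q , q<r = ℚ.<-dense x<r in q , q<r , x<q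
  ; disjoint    = uncurry ℚ.<-asym
  ; located     = located
  }
  where
  located : ∀ {q r} → q ℚ.< r → q ℚ.< x ⊎ x ℚ.< r
  located {q} q<r with q ℚ.<? x
  ... | yes q<x = inj₁ q<x
  ... | no q≮x  = inj₂ (ℚ.≤-<-trans (ℚ.≮⇒≥ q≮x) q<r)

fromℕᴿ : ℕ → ℝ
fromℕᴿ k = fromℚ (fromℤ (ℤ.+ k))

fromℕᴿ-mono-≤ : ∀ {j k} → j ≤ k → fromℕᴿ j ≤ᴿ fromℕᴿ k
fromℕᴿ-mono-≤ j≤k q q<j =
  ℚ.<-≤-trans q<j (ℚ.*≤* (ℤ.*-monoʳ-≤-nonNeg (ℤ.+ 1) (ℤ.+≤+ j≤k)))

fromℕᴿ-cancel-≤ : ∀ {j k} → fromℕᴿ j ≤ᴿ fromℕᴿ k → j ≤ k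
fromℕᴿ-cancel-≤ {j} {k} j≤k with ℕ.≤-<-connex j k
... | inj₁ j≤k = j≤k
... | inj₂ k<j = contradiction
  (j≤k (fromℤ (ℤ.+ k)) (*<* (ℤ.*-monoʳ-<-pos (ℤ.+ 1) (ℤ.+<+ k<j)))) (ℚ.<-irrefl refl)

-- Interval orders

-- Fishburn's characterisation: irreflexivity and the absence of an induced 2+2. Transitivity is the
-- case `w = v`.
IsIntervalOrder : Rel (Fin n) 0ℓ → Set
IsIntervalOrder _≪_ =
  (∀ u → ¬ u ≪ u) × (∀ u v w z → u ≪ v → w ≪ z → u ≪ z ⊎ w ≪ v)

-- The endpoints of u count the predecessors of u, and all predecessors of
-- the elements not to the right of u.
module IntervalModel {_≪_ : Rel (Fin n) 0ℓ} (_≪?_ : Decidable _≪_) (order : IsIntervalOrder _≪_) where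

  left-of? : ∀ v → U.Decidable (_≪ v)
  left-of? v x = x ≪? v

  ReachedBy : Fin n → U.Pred (Fin n) 0ℓ
  ReachedBy u x = ∃[ w ] (¬ u ≪ w × x ≪ w)

  reachedBy? : ∀ u → U.Decidable (ReachedBy u)
  reachedBy? u x = any? λ w → ¬? (u ≪? w) ×-dec (x ≪? w)

  lo hi : Fin n → ℕ
  lo v = count (left-of? v)
  hi u = count (reachedBy? u)

  -- The 2+2 condition puts everything reached by `u` to the left of `v`. Strictness comes from `u`
  -- itself, which is left of `v` but not reached by `u`.
  ≪⇒hi<lo : ∀ {u v} → u ≪ v → hi u < lo v
  ≪⇒hi<lo {u} {v} u≪v = length-filter-⊂ (reachedBy? u) (left-of? v)
    (λ {x} (w , u≪̸w , x≪w) → [ id , (λ u≪w → contradiction u≪w u≪̸w) ]′ (proj₂ order x w u v x≪w u≪v))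
    (∈-allFin u) (λ (w , u≪̸w , u≪w) → u≪̸w u≪w) u≪v

  ≪̸⇒lo≤hi : ∀ {u v} → ¬ u ≪ v → lo v ≤ hi u
  ≪̸⇒lo≤hi {u} {v} u≪̸v =
    length-filter-⊆ (left-of? v) (reachedBy? u) (λ x≪v → v , u≪̸v , x≪v) (allFin n)

-- Families of relations encoded as subsets of a finite set.

relations : ∀ c n → Subset (c * (n * n)) → Fin c → Rel (Fin n) 0ℓ
relations c n S i u v = combine i (combine u v) ∈ S

relations? : ∀ c n (S : Subset (c * (n * n))) i → Decidable (relations c n S i)
relations? c n S i u v = combine i (combine u v) ∈? S

entry : {R : Fin c → Rel (Fin n) 0ℓ} → (∀ i → Decidable (R i)) → Fin c → Fin n × Fin n → Bool
entry R? i (u , v) = does (R? i u v)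

entries : {R : Fin c → Rel (Fin n) 0ℓ} → (∀ i → Decidable (R i)) → Fin c × Fin (n * n) → Bool
entries {n = n} R? (i , uv) = entry R? i (remQuot {n} n uv)

encode : {R : Fin c → Rel (Fin n) 0ℓ} → (∀ i → Decidable (R i)) → Subset (c * (n * n))
encode {n = n} R? = tabulate (entries R? ∘ remQuot (n * n))

relations-encode : ∀ {c n} {R : Fin c → Rel (Fin n) 0ℓ} (R? : ∀ i → Decidable (R i)) →
                   ∀ i u v → R i u v ⇔ relations c n (encode R?) i u v
relations-encode {n = n} R? i u v = mk⇔
  (λ Riuv → lookup⇒[]= k (encode R?) (trans lookup-encode (dec-true (R? i u v) Riuv)))
  (λ k∈ → witness (R? i u v) (trans (sym lookup-encode) ([]=⇒lookup k∈)))
  where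
  k = combine i (combine u v)

  lookup-encode : lookup (encode R?) k ≡ does (R? i u v)
  lookup-encode = trans (lookup∘tabulate (entries R? ∘ remQuot (n * n)) k)
    (trans (cong (entries R?) (remQuot-combine i (combine u v)))
           (cong (entry R? i) (remQuot-combine u v)))

  witness : ∀ {A : Set} (A? : Dec A) → does A? ≡ true → A
  witness (yes a) _ = a

-- Box representations versus families of interval orders.

module _ (G : Graph n) where
  open Graph G

  Realises : (Fin c → Rel (Fin n) 0ℓ) → Set
  Realises R =
    (∀ i → IsIntervalOrder (R i)) ×
    (∀ u v → Adj u v → ∀ i → ¬ R i u v) ×
    (∀ u v → u ≢ v → (∀ i → ¬ R i u v × ¬ R i v u) → Adj u v)

  realises? : {R : Fin c → Rel (Fin n) 0ℓ} → (∀ i → Decidable (R i)) → Dec (Realises R)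
  realises? R? =
    (all? λ i → (all? λ u → ¬? (R? i u u)) ×-dec
      (all? λ u → all? λ v → all? λ w → all? λ z →
        R? i u v →-dec R? i w z →-dec (R? i u z ⊎-dec R? i w v))) ×-dec
    (all? λ u → all? λ v → adj? u v →-dec all? λ i → ¬? (R? i u v)) ×-dec
    (all? λ u → all? λ v → ¬? (u Fin.≟ v) →-dec
      (all? λ i → ¬? (R? i u v) ×-dec ¬? (R? i v u)) →-dec adj? u v)

  realises-resp-⇔ : {R S : Fin c → Rel (Fin n) 0ℓ} →
                    (∀ i u v → R i u v ⇔ S i u v) → Realises R → Realises S
  realises-resp-⇔ R⇔S (order , adj , sep) =
    (λ i → (λ u → proj₁ (order i) u ∘ from (R⇔S i u u)) ,
           (λ u v w z u≪v w≪z → Sum.map (to (R⇔S i u z)) (to (R⇔S i w v))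
             (proj₂ (order i) u v w z (from (R⇔S i u v) u≪v) (from (R⇔S i w z) w≪z)))) ,
    (λ u v uv i → adj u v uv i ∘ from (R⇔S i u v)) ,
    (λ u v u≢v unrelated → sep u v u≢v λ i →
      proj₁ (unrelated i) ∘ to (R⇔S i u v) , proj₂ (unrelated i) ∘ to (R⇔S i v u))

  realises⇒boxes : {R : Fin c → Rel (Fin n) 0ℓ} → (∀ i → Decidable (R i)) →
                   Realises R → IsBoxIntersectionGraph G c
  realises⇒boxes {c = c} {R = R} R? (order , adj , sep) =
    box , λ u v u≢v → mk⇔ (meet u v) (sep u v u≢v ∘ unrelated u v)
    where
    module I i = IntervalModel (R? i) (order i)

    box : Fin n → Box c
    box u i = record
      { lo    = fromℕᴿ (I.lo i u)
      ; hi    = fromℕᴿ (I.hi i u)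
      ; lo≤hi = fromℕᴿ-mono-≤ (I.≪̸⇒lo≤hi i (proj₁ (order i) u))
      }

    meet : ∀ u v → Adj u v → Intersect (box u) (box v)
    -- In each coordinate the larger of the two left endpoints is a common point.
    meet u v uv = (λ i → fromℕᴿ (I.lo i u ⊔ I.lo i v)) ,
      (λ i → fromℕᴿ-mono-≤ (ℕ.m≤m⊔n _ _) , fromℕᴿ-mono-≤ (ℕ.⊔-lub
        (I.≪̸⇒lo≤hi i (proj₁ (order i) u)) (I.≪̸⇒lo≤hi i (adj u v uv i)))) ,
      (λ i → fromℕᴿ-mono-≤ (ℕ.m≤n⊔m _ _) , fromℕᴿ-mono-≤ (ℕ.⊔-lub
        (I.≪̸⇒lo≤hi i (adj v u (symm uv) i)) (I.≪̸⇒lo≤hi i (proj₁ (order i) v))))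

    apart : ∀ u v → Intersect (box u) (box v) → ∀ i → ¬ R i u v
    apart u v (x , x∈u , x∈v) i u≪v = ℕ.<⇒≱ (I.≪⇒hi<lo i u≪v)
      (fromℕᴿ-cancel-≤ (≤ᴿ-trans (fromℕᴿ (I.lo i v)) (x i) (fromℕᴿ (I.hi i u)) (proj₁ (x∈v i)) (proj₂ (x∈u i))))

    unrelated : ∀ u v → Intersect (box u) (box v) → ∀ i → ¬ R i u v × ¬ R i v u
    unrelated u v (x , x∈u , x∈v) i = apart u v (x , x∈u , x∈v) i , apart v u (x , x∈v , x∈u) i

  -- The order of real numbers is undecidable, so the interval orders of
  -- a box representation are only decidable up to double negation.
  boxes⇒¬¬realises : IsBoxIntersectionGraph G c →
    ¬ ¬ (∃[ R ] ((∀ (i : Fin c) → Decidable (R i)) × Realises R))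
  boxes⇒¬¬realises {c = c} (box , adj⇔) none =
    ¬¬-sequence (λ i → ¬¬-sequence λ u → ¬¬-sequence λ v → ¬¬-excluded-middle {A = R i u v})
      λ R? → none (R , R? , order R? , adj , sep)
    where
    module I u i = ClosedInterval (box u i)

    -- Strictly left of, as a negated inequality rather than a rational gap. This suffices because
    -- each use below aims at falsity or at a decidable goal.
    R : Fin c → Rel (Fin n) 0ℓ
    R i u v = ¬ I.lo v i ≤ᴿ I.hi u i

    order : (∀ i u v → Dec (R i u v)) → ∀ i → IsIntervalOrder (R i)
    order R? i = (λ u u≪u → u≪u (I.lo≤hi u i)) , ferrers
      where
      ferrers : ∀ u v w z → R i u v → R i w z → R i u z ⊎ R i w v
      -- If both alternatives fail, compare the right endpoints of `u` and `w`: whichever is larger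
      -- reaches the left endpoint of its own supposed successor, `v` or `z`.
      ferrers u v w z u≪v w≪z = decidable-stable (R? i u z ⊎-dec R? i w v) λ neither →
        neither (inj₁ λ z≤u → neither (inj₂ λ v≤w →
          ¬¬-≤ᴿ-total (I.hi u i) (I.hi w i)
            [ (λ u≤w → w≪z (≤ᴿ-trans (I.lo z i) (I.hi u i) (I.hi w i) z≤u u≤w))
            , (λ w≤u → u≪v (≤ᴿ-trans (I.lo v i) (I.hi w i) (I.hi u i) v≤w w≤u)) ]′))

    adj : ∀ u v → Adj u v → ∀ i → ¬ R i u v
    adj u v uv i u≪v
      with x , x∈u , x∈v ← to (adj⇔ u v λ u≡v → irrefl u≡v uv) uv =
      u≪v (≤ᴿ-trans (I.lo v i) (x i) (I.hi u i) (proj₁ (x∈v i)) (proj₂ (x∈u i)))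

    sep : ∀ u v → u ≢ v → (∀ i → ¬ R i u v × ¬ R i v u) → Adj u v
    sep u v u≢v unrelated = decidable-stable (adj? u v) λ ¬uv →
      ¬¬-sequence ¬¬-common λ common →
        ¬uv (from (adj⇔ u v u≢v)
          ( (λ i → point i (common i))
          , (λ i → inU i (common i)) , (λ i → inV i (common i)) ))
      where
      -- Real points live in `Set₁`, out of reach of `¬¬-sequence`. This small type holds the
      -- inequalities instead, and its last component tells which left endpoint serves as `point`.
      Common : Fin c → Set
      Common i = I.lo v i ≤ᴿ I.hi u i × I.lo u i ≤ᴿ I.hi v i ×
                 (I.lo u i ≤ᴿ I.lo v i ⊎ I.lo v i ≤ᴿ I.lo u i)

      point : ∀ i → Common i → ℝ
      point i (_ , _ , inj₁ _) = I.lo v i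
      point i (_ , _ , inj₂ _) = I.lo u i

      ¬¬-common : ∀ i → ¬ ¬ Common i
      ¬¬-common i ¬common =
        proj₁ (unrelated i) λ v≤u → proj₂ (unrelated i) λ u≤v →
        ¬¬-≤ᴿ-total (I.lo u i) (I.lo v i) λ total → ¬common (v≤u , u≤v , total)

      inU : ∀ i (cm : Common i) → point i cm ∈ᴵ box u i
      inU i (v≤u , u≤v , inj₁ lo≤) = lo≤ , v≤u
      inU i (v≤u , u≤v , inj₂ lo≥) = ≤ᴿ-refl (I.lo u i) , I.lo≤hi u i

      inV : ∀ i (cm : Common i) → point i cm ∈ᴵ box v i
      inV i (v≤u , u≤v , inj₁ lo≤) = ≤ᴿ-refl (I.lo v i) , I.lo≤hi v i
      inV i (v≤u , u≤v , inj₂ lo≥) = lo≥ , u≤v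

  -- Exact boxicity by exhaustive search.

  Realisable : ℕ → Set
  Realisable c = ∃[ S ] Realises (relations c n S)

  realisable? : ∀ c → Dec (Realisable c)
  realisable? c = anySubset? λ S → realises? (relations? c n S)

  realises⇒realisable : {R : Fin c → Rel (Fin n) 0ℓ} → (∀ i → Decidable (R i)) →
                        Realises R → Realisable c
  realises⇒realisable R? real = encode R? , realises-resp-⇔ (relations-encode R?) real

  -- The least realisable dimension is the boxicity. A box representation yields interval orders
  -- only up to double negation, which is enough for minimality since `b ≤ c` is decidable.
  realisable⇒boxicity : ∀ m → Realisable m → ∃[ b ] (IsBoxicity G b × b ≤ m)
  realisable⇒boxicity m real
    with b , (S , realS) , b≤m , least ← least-witness realisable? m real =
    b , (realises⇒boxes (relations? b n S) realS , minimal) , b≤m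
    where
    minimal : ∀ c → IsBoxIntersectionGraph G c → b ≤ c
    minimal c boxes = decidable-stable (b ℕ.≤? c) λ b≰c →
      boxes⇒¬¬realises boxes λ (R , R? , realR) → b≰c (least c (realises⇒realisable R? realR))

  -- Graphs of bandwidth at most `w`.

  bandwidth⇒realisable : (pos : Fin n → ℕ) → Injective _≡_ _≡_ pos → ∀ w →
    (∀ u v → Adj u v → pos v ≤ pos u + w) → Realisable (suc w)
  bandwidth⇒realisable pos pos-injective w bandwidth = realises⇒realisable R? (order , adj , sep)
    where
    colour : Fin n → Fin (suc w)
    colour u = pos u mod suc w

    R : Fin (suc w) → Rel (Fin n) 0ℓ
    R i u v = colour u ≡ i × pos u < pos v ×
              (∀ t → colour t ≡ i → pos t ≤ pos u → ¬ Adj t v)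

    R? : ∀ i → Decidable (R i)
    R? i u v = (colour u Fin.≟ i) ×-dec (pos u ℕ.<? pos v) ×-dec
      all? λ t → (colour t Fin.≟ i) →-dec (pos t ℕ.≤? pos u) →-dec ¬? (adj? t v)

    -- Passing to an earlier vertex of the same colour relaxes the position condition and leaves
    -- fewer `t` to check. Hence the earlier of two left vertices inherits the relation of the
    -- other, which gives `ferrers`.
    shrink : ∀ {i u w z} → colour u ≡ i → pos u ≤ pos w → R i w z → R i u z
    shrink cu u≤w (cw , w<z , free) =
      cu , ℕ.≤-<-trans u≤w w<z , λ t ct t≤u → free t ct (ℕ.≤-trans t≤u u≤w)

    order : ∀ i → IsIntervalOrder (R i)
    order i = (λ u (_ , u<u , _) → ℕ.<-irrefl refl u<u) , ferrers
      where
      ferrers : ∀ u v w z → R i u v → R i w z → R i u z ⊎ R i w v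
      ferrers u v w z u≪v w≪z = Sum.map
        (λ u≤w → shrink (proj₁ u≪v) u≤w w≪z) (λ w≤u → shrink (proj₁ w≪z) w≤u u≪v)
        (ℕ.≤-total (pos u) (pos w))

    adj : ∀ u v → Adj u v → ∀ i → ¬ R i u v
    adj u v uv i (cu , _ , free) = free u cu ℕ.≤-refl uv

    colour-injective-nearby : ∀ {t u} → pos t < pos u → pos u ≤ pos t + w → colour t ≢ colour u
    colour-injective-nearby {t} {u} t<u u≤t+w ct≡cu = close⇒%-distinct (suc w) t<u
      -- A distance of at most `w` is strictly below the modulus `suc w`; this is where the extra
      -- colour is spent.
      (ℕ.≤-trans (s≤s u≤t+w) (ℕ.≤-reflexive (sym (ℕ.+-suc (pos t) w))))
      (trans (sym (toℕ-fromℕ< (m%n<n (pos t) (suc w))))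
        (trans (cong toℕ ct≡cu) (toℕ-fromℕ< (m%n<n (pos u) (suc w)))))

    separated : ∀ {u v} → pos u < pos v → ¬ Adj u v → R (colour u) u v
    separated {u} {v} u<v ¬uv = refl , u<v , free
      where
      free : ∀ t → colour t ≡ colour u → pos t ≤ pos u → ¬ Adj t v
      free t ct≡cu t≤u tv with ℕ.m≤n⇒m<n∨m≡n t≤u
      -- The edge keeps `v` within `w` of `t`, hence also `u`, which lies between them.
      ... | inj₁ t<u = colour-injective-nearby t<u (ℕ.≤-trans (ℕ.<⇒≤ u<v) (bandwidth t v tv)) ct≡cu
      ... | inj₂ t≡u = ¬uv (subst (λ x → Adj x v) (pos-injective t≡u) tv)

    sep : ∀ u v → u ≢ v → (∀ i → ¬ R i u v × ¬ R i v u) → Adj u v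
    sep u v u≢v unrelated with adj? u v | ℕ.<-cmp (pos u) (pos v)
    ... | yes uv | _              = uv
    ... | no ¬uv | tri< u<v _ _   = contradiction (separated u<v ¬uv) (proj₁ (unrelated (colour u)))
    ... | no ¬uv | tri≈ _ pu≡pv _ = contradiction (pos-injective pu≡pv) u≢v
    ... | no ¬uv | tri> _ _ v<u   = contradiction (separated v<u (¬uv ∘ symm)) (proj₂ (unrelated (colour v)))

  degree≤Δ : ∀ v → degree G v ≤ Δ G
  degree≤Δ v = All.lookup (map⁻ (xs≤max 0 (map (degree G) (allFin n)))) (∈-allFin v)

  -- A linear extension of the order of the complement, and its bandwidth.

  module LinearExtension {_⊑_ : Rel (Fin n) 0ℓ} (po : IsPartialOrder _≡_ _⊑_)
    (nonadj⇔ : ∀ u v → u ≢ v → (u ≢ v × ¬ Adj u v) ⇔ (u ⊑ v ⊎ v ⊑ u)) where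

    private module PO = IsPartialOrder po

    _⊏_ : Rel (Fin n) 0ℓ
    u ⊏ v = u ⊑ v × u ≢ v

    ⊏-trans : ∀ {u v w} → u ⊏ v → v ⊏ w → u ⊏ w
    ⊏-trans (u⊑v , u≢v) (v⊑w , _) =
      PO.trans u⊑v v⊑w , λ { refl → u≢v (PO.antisym u⊑v v⊑w) }

    ⊏⇒¬Adj : ∀ {u v} → u ⊏ v → ¬ Adj u v
    ⊏⇒¬Adj {u} {v} (u⊑v , u≢v) = proj₂ (from (nonadj⇔ u v u≢v) (inj₁ u⊑v))

    ¬Adj⇒⊏⊎⊐ : ∀ {u v} → u ≢ v → ¬ Adj u v → u ⊏ v ⊎ v ⊏ u
    ¬Adj⇒⊏⊎⊐ {u} {v} u≢v ¬uv =
      Sum.map (_, u≢v) (_, u≢v ∘ sym) (to (nonadj⇔ u v u≢v) (u≢v , ¬uv))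

    -- The given order carries no decision procedure. Adjacency does, and distinct non-adjacent
    -- vertices come with a comparison whose direction is unique by antisymmetry.
    _⊏?_ : Decidable _⊏_
    u ⊏? v with u Fin.≟ v | adj? u v
    ... | yes u≡v | _      = no λ (_ , u≢v) → u≢v u≡v
    ... | no _    | yes uv = no λ u⊏v → ⊏⇒¬Adj u⊏v uv
    ... | no u≢v  | no ¬uv with ¬Adj⇒⊏⊎⊐ u≢v ¬uv
    ...   | inj₁ u⊏v       = yes u⊏v
    ...   | inj₂ (v⊑u , _) = no λ (u⊑v , _) → u≢v (PO.antisym u⊑v v⊑u)

    height : Fin n → ℕ
    height v = count (_⊏? v)

    height<1+n : ∀ v → height v < suc n
    height<1+n v = s≤s (count-≤ (_⊏? v))

    -- Lexicographic order on height and index: height strictly increases along `_⊏_`, and the index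
    -- breaks ties.
    key : Fin n → Fin (suc n * n)
    key v = combine (fromℕ< (height<1+n v)) v

    key-injective : ∀ {u v} → key u ≡ key v → u ≡ v
    key-injective {u} {v} = combine-injectiveʳ (fromℕ< (height<1+n u)) u (fromℕ< (height<1+n v)) v

    key-mono : ∀ {u v} → u ⊏ v → key u Fin.< key v
    key-mono {u} {v} u⊏v = combine-monoˡ-< u v
      (subst₂ _<_ (sym (toℕ-fromℕ< (height<1+n u))) (sym (toℕ-fromℕ< (height<1+n v)))
        (length-filter-⊂ (_⊏? u) (_⊏? v) (λ x⊏u → ⊏-trans x⊏u u⊏v) (∈-allFin u)
          (λ (_ , u≢u) → u≢u refl) u⊏v))

    before? : ∀ v → U.Decidable (λ x → key x Fin.< key v)
    before? v x = key x Fin.<? key v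

    -- Keys may leave gaps. With ranks, a difference of positions counts vertices, which is what
    -- `bandwidth` estimates.
    pos : Fin n → ℕ
    pos v = count (before? v)

    key<⇒pos< : ∀ {u v} → key u Fin.< key v → pos u < pos v
    key<⇒pos< {u} {v} u<v = length-filter-⊂ (before? u) (before? v)
      (λ x<u → ℕ.<-trans x<u u<v) (∈-allFin u) (ℕ.<-irrefl refl) u<v

    pos-injective : Injective _≡_ _≡_ pos
    pos-injective {u} {v} pu≡pv with Fin.<-cmp (key u) (key v)
    ... | tri< u<v _ _ = contradiction pu≡pv (ℕ.<⇒≢ (key<⇒pos< u<v))
    ... | tri≈ _ u≡v _ = key-injective u≡v
    ... | tri> _ _ v<u = contradiction (sym pu≡pv) (ℕ.<⇒≢ (key<⇒pos< v<u))

    key-⊏ : ∀ {u v} → u ≢ v → ¬ Adj u v → key u Fin.≤ key v → u ⊏ v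
    key-⊏ u≢v ¬uv u≤v = [ id , (λ v⊏u → contradiction u≤v (ℕ.<⇒≱ (key-mono v⊏u))) ]′ (¬Adj⇒⊏⊎⊐ u≢v ¬uv)

    -- The order of `u` and `v` is left open: if `v` comes first, the first alternative always
    -- applies.
    before-⊆ : ∀ {u v} → Adj u v → ∀ {x} → key x Fin.< key v →
               key x Fin.< key u ⊎ (Adj u x ⊎ Adj v x)
    before-⊆ {u} {v} uv {x} x<v with key x Fin.<? key u | adj? u x | adj? v x
    ... | yes x<u | _      | _      = inj₁ x<u
    ... | no _    | yes ux | _      = inj₂ (inj₁ ux)
    ... | no _    | no _   | yes vx = inj₂ (inj₂ vx)
    ... | no x≮u  | no ¬ux | no ¬vx = contradiction uv (⊏⇒¬Adj (⊏-trans u⊏x x⊏v))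
      where
      u⊏x : u ⊏ x
      -- `x` differs from `u` because `u` is a neighbour of `v` and `x` is not.
      u⊏x = key-⊏ (λ { refl → ¬vx (symm uv) }) ¬ux (ℕ.≮⇒≥ x≮u)
      x⊏v : x ⊏ v
      x⊏v = key-⊏ (λ { refl → ℕ.<-irrefl refl x<v }) (¬vx ∘ symm) (ℕ.<⇒≤ x<v)

    bandwidth : ∀ u v → Adj u v → pos v ≤ pos u + 2 * Δ G
    bandwidth u v uv = begin
      pos v                                  ≤⟨ length-filter-∪ (before? v) (before? u) nbr? (before-⊆ uv) (allFin n) ⟩
      pos u + count nbr?                     ≤⟨ ℕ.+-monoʳ-≤ (pos u) (length-filter-∪ nbr? (adj? u) (adj? v) id (allFin n)) ⟩
      pos u + (degree G u + degree G v)      ≤⟨ ℕ.+-monoʳ-≤ (pos u) (ℕ.+-mono-≤ (degree≤Δ u) (degree≤Δ v)) ⟩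
      pos u + (Δ G + Δ G)                    ≡⟨ cong (λ k → pos u + (Δ G + k)) (ℕ.+-identityʳ (Δ G)) ⟨
      pos u + 2 * Δ G                        ∎
      where
      open ≤-Reasoning
      nbr? : U.Decidable (λ x → Adj u x ⊎ Adj v x)
      nbr? x = adj? u x ⊎-dec adj? v x

theorem8 : (n : ℕ) (G : Graph n) → IsCoComparability G →
    ∃[ b ] (IsBoxicity G b × b ≤ 2 * Δ G + 1)
theorem8 n G (_ , po , nonadj⇔) =
  realisable⇒boxicity G (2 * Δ G + 1) (subst (Realisable G) (ℕ.+-comm 1 (2 * Δ G))
    (bandwidth⇒realisable G pos pos-injective (2 * Δ G) bandwidth))
  where open LinearExtension G po nonadj⇔
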